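{- $W_c(4,2)=34$. More precisely: there is a 2-coloring of $\mathbb{Z}_{33}$ with no monochromatic non-degenerate 4-AP, while for every $M\ge 34$ every 2-coloring of $\mathbb{Z}_M$ contains a monochromatic non-degenerate 4-AP.
   Context: For an integer $M\ge1$, a 4-AP in $\mathbb{Z}_M=\mathbb{Z}/M\mathbb{Z}$ is a tuple $(i,i+r,i+2r,i+3r)\pmod M$ with $i\in\mathbb{Z}_M$ and $r\in\{1,\dots,M-1\}$; it is non-degenerate if its four residues are pairwise distinct, and monochromatic under a coloring $\chi:\mathbb{Z}_M\to\{B,R\}$ if all four terms receive the same color. The cyclic van der Waerden number $W_c(4,2)$ is the smallest $N$ such that for all $M\ge N$, every 2-coloring of $\mathbb{Z}_M$ contains a monochromatic non-degenerate 4-AP. -}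

module Defs where

open import Data.Fin using (Fin; toℕ)
open import Data.Nat using (ℕ; NonZero; _+_; _*_; _≤_; _<_)
open import Data.Nat.DivMod using (_mod_)
open import Data.Product using (∃-syntax; _×_)
open import Data.Vec.Functional using (Vector)
open import Function.Definitions using (Injective)
open import Relation.Binary.PropositionalEquality using (_≡_)

data Color : Set where
  B R : Color

-- ℤ/Mℤ, each class being represented by its residue in {0, …, M − 1}.
ℤ/ : ℕ → Set
ℤ/ M = Fin M

Coloring : ℕ → Set
Coloring M = ℤ/ M → Color

Is4AP : (M : ℕ) .{{_ : NonZero M}} → Vector (ℤ/ M) 4 → Set
Is4AP M a =
  ∃[ i ] ∃[ r ] (1 ≤ r × r < M × (∀ j → a j ≡ (toℕ {M} i + toℕ j * r) mod M))

NonDegenerate : ∀ {M} → Vector (ℤ/ M) 4 → Set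
NonDegenerate a = Injective _≡_ _≡_ a

Monochromatic : ∀ {M} → Coloring M → Vector (ℤ/ M) 4 → Set
Monochromatic χ a = ∃[ c ] (∀ j → χ (a j) ≡ c)

HasMonochromatic4AP : (M : ℕ) .{{_ : NonZero M}} → Coloring M → Set
HasMonochromatic4AP M χ =
  ∃[ a ] (Is4AP M a × NonDegenerate a × Monochromatic χ a)

CyclicVdWBound : ℕ → Set
CyclicVdWBound N =
  ∀ M .{{_ : NonZero M}} → N ≤ M → (χ : Coloring M) → HasMonochromatic4AP M χ

-- W_c(4,2) = N as a relation: constructively, the number itself is only
-- available once some bound is known to exist.
Wc[4,2]≡_ : ℕ → Set
Wc[4,2]≡ N = CyclicVdWBound N × (∀ N′ → CyclicVdWBound N′ → N ≤ N′)

{-# OPTIONS --safe #-}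
-- Upper bound: lift χ : ℤ/M → Color to an M-periodic colouring of ℕ. Since the
-- classical van der Waerden number is W(4,2) = 35, some progression i, …, i + 3r ≤ 34
-- is monochromatic. As 3 does not divide 34, even 3r ≤ 33 < M, so
-- it stays non-degenerate modulo M; this is what gains one over 35. That W(4,2) ≤ 35 is a search
-- through the roughly 20000 progression-free colourings of initial segments of ℕ.
-- Lower bound: colour ℤ/33 by the quadratic residues modulo 11. A step divisible
-- by 11 gives a degenerate progression, and ℤ/11 has no monochromatic one.
module Submission where

open import Defs
open import Data.Bool using (Bool; false; T; _∧_; _∨_)
open import Data.Bool.Properties using (T-∧; T-∨)
open import Data.Fin using (Fin; toℕ; fromℕ<)
open import Data.Fin.Patterns using (0F; 1F; 2F; 3F)
open import Data.Fin.Properties as Fin using (all?; toℕ-fromℕ<; toℕ-injective; toℕ≤pred[n])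
open import Data.List using (List; []; _∷_)
open import Data.Nat using (ℕ; zero; suc; NonZero; _+_; _*_; _∸_; _/_; _%_; _≤_; _<_; s≤s; s≤s⁻¹; z≤n)
open import Data.Nat.Divisibility using (_∣_; divides; n∣m⇒m%n≡0; ∣m+n∣m⇒∣n)
open import Data.Nat.DivMod using (_mod_; m≡m%n+[m/n]*n; m<n⇒m%n≡m)
open import Data.Nat.Properties
open import Data.Nat.Tactic.RingSolver using (solve-∀)
open import Data.Product using (∃-syntax; _×_; _,_; proj₁; proj₂)
open import Data.Sum using (inj₁; inj₂)
open import Data.Unit using (tt)
open import Data.Vec.Functional using (Vector)
open import Function using (Equivalence)
open import Relation.Binary using (DecidableEquality)
open import Relation.Binary.PropositionalEquality
open import Relation.Nullary using (¬_; yes; no; contradiction)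
open import Relation.Nullary.Decidable using (⌊_⌋; from-yes; toWitness; _×-dec_; _→-dec_)

_≟ᶜ_ : DecidableEquality Color
B ≟ᶜ B = yes refl
B ≟ᶜ R = no λ ()
R ≟ᶜ B = no λ ()
R ≟ᶜ R = yes refl

Mono4AP< : ℕ → (ℕ → Color) → Set
Mono4AP< N f =
  ∃[ i ] ∃[ r ] (1 ≤ r × i + 3 * r < N × ∃[ c ] (∀ (j : Fin 4) → f (i + toℕ j * r) ≡ c))

-- The most recent value comes first.
prefix : (ℕ → Color) → ℕ → List Color
prefix f zero    = []
prefix f (suc n) = f n ∷ prefix f n

-- completes c w w w says that appending c to w creates a progression of colour c.
-- The three copies of w are walked at speeds 1, 2 and 3, so that in round r the
-- entries x, y, z are those at distance r, 2r, 3r from the new one.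
completes : Color → List Color → List Color → List Color → Bool
completes c (x ∷ xs) (_ ∷ y ∷ ys) (_ ∷ _ ∷ z ∷ zs) =
  ⌊ (x ≟ᶜ c) ×-dec (y ≟ᶜ c) ×-dec (z ≟ᶜ c) ⌋ ∨ completes c xs ys zs
completes _ _ _ _ = false

-- The number is the remaining search depth; at depth zero the answer is `false`, since `w` has then
-- survived.
unavoidable : ℕ → List Color → Bool
unavoidable zero    w = false
unavoidable (suc k) w = branch B ∧ branch R
  where
  branch : Color → Bool
  branch c = completes c w w w ∨ unavoidable k (c ∷ w)

shift₂ : ∀ q k → q + 2 * suc k ≡ suc (suc q) + 2 * k
shift₂ = solve-∀

shift₃ : ∀ s k → s + 3 * suc k ≡ suc (suc (suc s)) + 3 * k
shift₃ = solve-∀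

-- Loop invariant after `k` rounds: the three lists are the prefixes of lengths `m - k`, `m - 2k`
-- and `m - 3k`, stated additively to avoid truncated subtraction.
completes-sound : ∀ f m k p q s → p + k ≡ m → q + 2 * k ≡ m → s + 3 * k ≡ m →
  T (completes (f m) (prefix f p) (prefix f q) (prefix f s)) → Mono4AP< (suc m) f
completes-sound f m k (suc p) (suc (suc q)) (suc (suc (suc s))) p≡ q≡ s≡ t
  with Equivalence.to T-∨ t
... | inj₂ t′ = completes-sound f m (suc k) p q s
  (trans (+-suc p k) p≡) (trans (shift₂ q k) q≡) (trans (shift₃ s k) s≡) t′
... | inj₁ t′ = s , suc k , s≤s z≤n , s≤s (≤-reflexive s+3r≡m) , f m , colour
  where
  mono = toWitness t′
  s+3r≡m : s + 3 * suc k ≡ m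
  s+3r≡m = trans (shift₃ s k) s≡
  term₂ : ∀ s k → s + 2 * suc k + suc k ≡ suc (suc (suc s)) + 3 * k
  term₂ = solve-∀
  s+2r≡p : s + 2 * suc k ≡ p
  s+2r≡p = +-cancelʳ-≡ (suc k) (s + 2 * suc k) p
    (trans (term₂ s k) (trans s≡ (trans (sym p≡) (sym (+-suc p k)))))
  term₁ : ∀ s k → s + 1 * suc k + 2 * suc k ≡ suc (suc (suc s)) + 3 * k
  term₁ = solve-∀
  s+r≡q : s + 1 * suc k ≡ q
  s+r≡q = +-cancelʳ-≡ (2 * suc k) (s + 1 * suc k) q
    (trans (term₁ s k) (trans s≡ (trans (sym q≡) (sym (shift₂ q k)))))
  colour : ∀ (j : Fin 4) → f (s + toℕ j * suc k) ≡ f m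
  colour 0F = trans (cong f (+-identityʳ s)) (proj₂ (proj₂ mono))
  colour 1F = trans (cong f s+r≡q) (proj₁ (proj₂ mono))
  colour 2F = trans (cong f s+2r≡p) (proj₁ mono)
  colour 3F = cong f s+3r≡m

Mono4AP<-weaken : ∀ f {m n} → m ≤ n → Mono4AP< m f → Mono4AP< n f
Mono4AP<-weaken f m≤n (i , r , 1≤r , last< , mono) = i , r , 1≤r , <-≤-trans last< m≤n , mono

-- Of the two branches only the one for `f n` is followed, because its list is `prefix f (suc n)` by
-- definition.
unavoidable-sound : ∀ f k n → T (unavoidable k (prefix f n)) → Mono4AP< (n + k) f
unavoidable-sound f (suc k) n t with Equivalence.to T-∨ (branch (f n) (Equivalence.to T-∧ t))
  where
  w = prefix f n
  Branch : Color → Set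
  Branch c = T (completes c w w w ∨ unavoidable k (c ∷ w))
  branch : ∀ c → Branch B × Branch R → Branch c
  branch B = proj₁
  branch R = proj₂
... | inj₁ t′ = Mono4AP<-weaken f n<n+suck
  (completes-sound f n 0 n n n (+-identityʳ n) (+-identityʳ n) (+-identityʳ n) t′)
  where
  n<n+suck : n < n + suc k
  n<n+suck = subst (n <_) (sym (+-suc n k)) (s≤s (m≤m+n n k))
... | inj₂ t′ = subst (λ N → Mono4AP< N f) (sym (+-suc n k)) (unavoidable-sound f k (suc n) t′)

W[4,2]≤35 : ∀ f → Mono4AP< 35 f
-- Checking `tt` runs the whole search, from the empty prefix to depth 35.
W[4,2]≤35 f = unavoidable-sound f 35 0 tt

-- Equal remainders make `d` a multiple of `n`, and the only multiple below `n` is 0.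
%-cancel : ∀ x d n .{{_ : NonZero n}} → d < n → x % n ≡ (x + d) % n → d ≡ 0
%-cancel x d n d<n eq = trans (sym (m<n⇒m%n≡m d<n)) (n∣m⇒m%n≡0 d n n∣d)
  where
  open ≡-Reasoning
  n∣d : n ∣ d
  n∣d = ∣m+n∣m⇒∣n (divides ((x + d) / n) (+-cancelˡ-≡ (x % n) _ _ (begin
    x % n + (x / n * n + d)               ≡⟨ +-assoc (x % n) _ d ⟨
    x % n + x / n * n + d                 ≡⟨ cong (_+ d) (m≡m%n+[m/n]*n x n) ⟨
    x + d                                 ≡⟨ m≡m%n+[m/n]*n (x + d) n ⟩
    (x + d) % n + (x + d) / n * n         ≡⟨ cong (_+ (x + d) / n * n) eq ⟨
    x % n + (x + d) / n * n               ∎)))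
    (divides (x / n) refl)

mod⇒% : ∀ x y n .{{_ : NonZero n}} → x mod n ≡ y mod n → x % n ≡ y % n
mod⇒% x y n eq = trans (sym (toℕ-fromℕ< _)) (trans (cong toℕ eq) (toℕ-fromℕ< _))

terms-injective-≤ : ∀ x r {M} .{{_ : NonZero M}} → 1 ≤ r → ∀ {j k} → j ≤ k → k * r < M →
  (x + j * r) mod M ≡ (x + k * r) mod M → j ≡ k
terms-injective-≤ x r@(suc _) {M} _ {j} {k} j≤k kr<M eq =
  ≤-antisym j≤k (m∸n≡0⇒m≤n (m*n≡0⇒m≡0 (k ∸ j) r gap≡0))
  where
  split : x + k * r ≡ x + j * r + (k ∸ j) * r
  split = begin
    x + k * r                   ≡⟨ cong (λ l → x + l * r) (m+[n∸m]≡n j≤k) ⟨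
    x + (j + (k ∸ j)) * r       ≡⟨ cong (x +_) (*-distribʳ-+ r j (k ∸ j)) ⟩
    x + (j * r + (k ∸ j) * r)   ≡⟨ +-assoc x (j * r) _ ⟨
    x + j * r + (k ∸ j) * r     ∎
    where open ≡-Reasoning
  gap≡0 : (k ∸ j) * r ≡ 0
  gap≡0 = %-cancel (x + j * r) _ M (≤-<-trans (*-monoˡ-≤ r (m∸n≤m k j)) kr<M)
    (trans (mod⇒% (x + j * r) (x + k * r) M eq) (cong (_% M) split))

terms-nonDegenerate : ∀ x r {M} .{{_ : NonZero M}} → 1 ≤ r → 3 * r < M →
  NonDegenerate {M} (λ (j : Fin 4) → (x + toℕ j * r) mod M)
terms-nonDegenerate x r {M} 1≤r 3r<M {j} {k} eq = toℕ-injective (case-≤ (≤-total (toℕ j) (toℕ k)))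
  where
  bound : ∀ (l : Fin 4) → toℕ l * r < M
  bound l = ≤-<-trans (*-monoˡ-≤ r (toℕ≤pred[n] l)) 3r<M
  case-≤ : _ → toℕ j ≡ toℕ k
  case-≤ (inj₁ j≤k) = terms-injective-≤ x r 1≤r j≤k (bound k) eq
  case-≤ (inj₂ k≤j) = sym (terms-injective-≤ x r 1≤r k≤j (bound j) (sym eq))

cyclicVdWBound34 : CyclicVdWBound 34
cyclicVdWBound34 M 34≤M χ with W[4,2]≤35 (λ n → χ (n mod M))
... | i , r , 1≤r , last<35 , c , mono =
  (λ j → (i + toℕ j * r) mod M) ,
  (fromℕ< i<M , r , 1≤r , r<M , λ j → cong (λ x → (x + toℕ j * r) mod M) (sym (toℕ-fromℕ< i<M))) ,
  terms-nonDegenerate i r 1≤r 3r<M ,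
  (c , mono)
  where
  i+3r≤34 : i + 3 * r ≤ 34
  i+3r≤34 = s≤s⁻¹ last<35
  r≤3r : r ≤ 3 * r
  r≤3r = m≤m+n r (2 * r)
  i<M : i < M
  i<M = ≤-trans (m<m+n i (≤-trans 1≤r r≤3r)) (≤-trans i+3r≤34 34≤M)
  -- From `3 * r ≤ 34 < 36`; integrality of `r` then gives `3 * r ≤ 33`.
  r<12 : r < 12
  r<12 = *-cancelˡ-< 3 r 12 (<-≤-trans (s≤s (≤-trans (m≤n+m (3 * r) i) i+3r≤34)) (n≤1+n 35))
  3r<M : 3 * r < M
  3r<M = <-≤-trans (s≤s (*-monoʳ-≤ 3 (s≤s⁻¹ r<12))) 34≤M
  r<M : r < M
  r<M = ≤-<-trans r≤3r 3r<M

-- `R` marks the nonzero squares modulo 11; 0 joins the non-residues in `B`.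
quadraticResidue11 : ℕ → Color
quadraticResidue11 1 = R
quadraticResidue11 3 = R
quadraticResidue11 4 = R
quadraticResidue11 5 = R
quadraticResidue11 9 = R
quadraticResidue11 _ = B

χ₃₃ : Coloring 33
χ₃₃ x = quadraticResidue11 (toℕ x % 11)

term₃₃ : Fin 33 → Fin 33 → Vector (ℤ/ 33) 4
term₃₃ i r j = (toℕ i + toℕ j * toℕ r) mod 33

-- Checked by evaluation over all pairs. The first and last terms are the ones that meet, because
-- `3 * r` vanishes modulo 33 when 11 divides `r`.
monochromatic⇒degenerate : ∀ i r →
  (∀ j → χ₃₃ (term₃₃ i r j) ≡ χ₃₃ (term₃₃ i r 0F)) → term₃₃ i r 0F ≡ term₃₃ i r 3F
monochromatic⇒degenerate = from-yes (all? λ i → all? λ r →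
  all? (λ j → χ₃₃ (term₃₃ i r j) ≟ᶜ χ₃₃ (term₃₃ i r 0F)) →-dec
  (term₃₃ i r 0F Fin.≟ term₃₃ i r 3F))

χ₃₃-avoids : ¬ HasMonochromatic4AP 33 χ₃₃
χ₃₃-avoids (a , (i , r , 1≤r , r<33 , a≡) , nonDegenerate , c , mono) =
  contradiction (nonDegenerate {0F} {3F} (trans (a≡term 0F) (trans a₀≡a₃ (sym (a≡term 3F))))) λ ()
  where
  r′ : Fin 33
  r′ = fromℕ< r<33
  a≡term : ∀ j → a j ≡ term₃₃ i r′ j
  a≡term j = trans (a≡ j) (cong (λ s → (toℕ i + toℕ j * s) mod 33) (sym (toℕ-fromℕ< r<33)))
  colour : ∀ j → χ₃₃ (term₃₃ i r′ j) ≡ c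
  colour j = trans (cong χ₃₃ (sym (a≡term j))) (mono j)
  a₀≡a₃ : term₃₃ i r′ 0F ≡ term₃₃ i r′ 3F
  a₀≡a₃ = monochromatic⇒degenerate i r′ (λ j → trans (colour j) (sym (colour 0F)))

theorem11 : (Wc[4,2]≡ 34)
    × (∃[ χ ] (¬ HasMonochromatic4AP 33 χ))
    × (∀ M .{{_ : NonZero M}} → 34 ≤ M → (χ : Coloring M) → HasMonochromatic4AP M χ)
theorem11 = (cyclicVdWBound34 , least) , (χ₃₃ , χ₃₃-avoids) , cyclicVdWBound34
  where
  least : ∀ N → CyclicVdWBound N → 34 ≤ N
  -- A bound of at most 33 would apply to `χ₃₃` itself.
  least N bound = ≮⇒≥ λ N<34 → χ₃₃-avoids (bound 33 (s≤s⁻¹ N<34) χ₃₃)
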